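{- (i) Hamiltonian $2$-cycles on $[n]$ over $\mathbb{F}_2$ exist if and only if $n \equiv 0$ or $3 \pmod 4$. (ii) For every $d\geq 1$ and $n$, the maximum size of a simple $d$-cycle over $\mathbb{F}_2$ on $[n]$ is at least $\binom{n-1}{d} - \binom{n-1}{d-2} + 1$.
   Context: All chains are over $\mathbb{F}_2$ and identified with their supports (sets of simplices). A $d$-simplex is a $(d+1)$-element subset of $[n]$. The boundary $\partial X$ of a set $X$ of $d$-simplices is the set of $(d-1)$-simplices contained in an odd number of members of $X$. A $d$-cycle is a set $Z$ of $d$-simplices with $\partial Z=\emptyset$; it is simple if it is nonempty and no nonempty proper subset of it is a $d$-cycle. A $d$-cycle on $[n]$ is Hamiltonian if it is simple and has size $\binom{n-1}{d}+1$. Convention: $\binom{n}{k}=0$ for $k<0$.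
   Formalization: Part (i) is proved for n ≥ 4 and part (ii) for n ≥ d+2; for smaller n there are no d-cycles on [n] at all, so (i) as written fails at n = 3 and the maximum in (ii) is over an empty set. -}

module Defs where

open import Data.Nat using (ℕ; zero; suc; _∸_; _+_)
open import Data.Nat.Divisibility using (_∣_)
open import Data.Nat.Combinatorics using (_C_)
open import Data.Fin.Subset using (Subset; ∣_∣; _⊆_)
open import Data.Fin.Subset.Properties using (_⊆?_)
open import Data.List using (List; []; length; filter)
open import Data.List.Membership.Propositional using (_∈_; _∉_)
open import Data.List.Relation.Unary.All using (All)
open import Data.List.Relation.Unary.Unique.Propositional using (Unique)
open import Data.Product using (_×_; ∃)
open import Relation.Binary.PropositionalEquality using (_≡_; _≢_)
open import Relation.Nullary using (¬_)

-- A set of d-simplices on [n] = Fin n: a duplicate-free list of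
-- subsets of Fin n, each of cardinality d + 1.
IsChain : (n d : ℕ) → List (Subset n) → Set
IsChain n d X = All (λ s → ∣ s ∣ ≡ suc d) X × Unique X

countContaining : {n : ℕ} → Subset n → List (Subset n) → ℕ
countContaining τ X = length (filter (λ s → τ ⊆? s) X)

InBoundary : (n d : ℕ) → List (Subset n) → Subset n → Set
InBoundary n d X τ = (∣ τ ∣ ≡ d) × ¬ (2 ∣ countContaining τ X)

IsCycle : (n d : ℕ) → List (Subset n) → Set
IsCycle n d Z = IsChain n d Z × (∀ τ → ¬ InBoundary n d Z τ)

NonemptyProperSubset : {n : ℕ} → List (Subset n) → List (Subset n) → Set
NonemptyProperSubset Y Z =
  Unique Y × (∀ {s} → s ∈ Y → s ∈ Z) × (Y ≢ []) × ∃ (λ s → s ∈ Z × s ∉ Y)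

IsSimpleCycle : (n d : ℕ) → List (Subset n) → Set
IsSimpleCycle n d Z =
  IsCycle n d Z × (Z ≢ []) ×
  (∀ Y → NonemptyProperSubset Y Z → ¬ IsCycle n d Y)

IsHamiltonian : (n d : ℕ) → List (Subset n) → Set
IsHamiltonian n d Z = IsSimpleCycle n d Z × (length Z ≡ ((n ∸ 1) C d) + 1)

-- binomial C(m, d-2) with the convention C(m,k) = 0 for k < 0
choose-d-2 : ℕ → ℕ → ℕ
choose-d-2 m zero = 0
choose-d-2 m (suc zero) = 0
choose-d-2 m (suc (suc k)) = m C k

{-# OPTIONS --safe #-}
module Submission where

-- Let Z be a nonzero (d-1)-cycle on n vertices and v a vertex of its support, so
-- Z = A + vL with ∂A = L.  If G is an acyclic filling of L and B an acyclic filling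
-- of A + G, both on the other n-1 vertices, then B + vG is an acyclic filling of Z.
-- As the deficiency bound C(n-1,d-2) satisfies Pascal's rule, bounds on |G| and |B|
-- add up to the bound C(n-1,d) - C(n-1,d-2) ≤ |B + vG|.  The only obstruction is
-- A + G = 0, avoided by asking for many different fillings G when n > 2d and
-- harmless when n ≤ 2d, where the bound on |B| is vacuous.
-- If moreover Z is simple and F is an acyclic filling of it, F together with the
-- cone over Z from a new vertex is a simple d-cycle; iterating in d gives (ii).
-- For d = 2 the cycle obtained has C(n-1,2) or C(n-1,2) + 1 triangles.  Counting
-- (edge, triangle) incidences shows that every 2-cycle has even size, so (i) is a
-- matter of the parity of C(n-1,2).

open import Defs
open import Algebra.Bundles using (CommutativeRing)
open import Data.Bool using (Bool; true; false; T; not; _∧_; _xor_; if_then_else_)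
open import Data.Bool.Properties using (xor-same; xor-identityʳ; xor-comm; not-distribˡ-xor; not-distribʳ-xor; not-involutive; ∧-zeroʳ; xor-∧-commutativeRing) renaming (_≟_ to _≟ᵇ_)
open import Data.Fin using (Fin; zero; suc) renaming (_≟_ to _≟ᶠ_)
open import Data.Fin.Subset using (Subset; inside; outside; ∣_∣; ⊥; ⁅_⁆)
open import Data.Fin.Subset.Properties using (_⊆?_; anySubset?; ∣⁅x⁆∣≡1; ∣⊥∣≡0; p⊆q⇒∣p∣≤∣q∣)
open import Data.List using (List; []; _∷_; length; map; filter; _++_)
open import Data.List.Membership.Propositional using (_∈_; _∉_)
open import Data.List.Membership.Propositional.Properties using (∈-map⁺; ∈-map⁻; ∈-++⁺ˡ; ∈-++⁺ʳ; ∈-++⁻)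
open import Data.List.Properties using (length-++; length-map; filter-notAll)
open import Data.List.Relation.Unary.All using (All; []; _∷_)
import Data.List.Relation.Unary.All as All
import Data.List.Relation.Unary.All.Properties as Allₚ
open import Data.List.Relation.Unary.Any using (here; there)
open import Data.List.Relation.Unary.AllPairs using ([]; _∷_)
open import Data.List.Relation.Unary.Unique.Propositional using (Unique)
open import Data.List.Relation.Unary.Unique.Propositional.Properties using (map⁺; ++⁺)
open import Data.Nat using (ℕ; zero; suc; _+_; _∸_; _≤_; _<_; _%_; _≡ᵇ_; z≤n; s≤s)
open import Data.Nat.Combinatorics using (_C_; nCk+nC[k+1]≡[n+1]C[k+1]; nCk≡nC[n∸k]; nC1≡n)
open import Data.Nat.Divisibility using (_∣_; divides)
open import Data.Nat.Properties
open import Data.Product using (_×_; _,_; proj₁; proj₂; Σ; ∃)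
open import Data.Sum using (_⊎_; inj₁; inj₂)
open import Data.Unit using (tt)
open import Data.Vec using ([]; _∷_; lookup; insertAt; removeAt)
open import Data.Vec.Properties using (lookup-replicate; ∷-injectiveʳ; insertAt-lookup; removeAt-insertAt; insertAt-removeAt)
open import Function.Bundles using (_⇔_; mk⇔)
open import Relation.Binary.PropositionalEquality using (_≡_; _≢_; _≗_; refl; sym; trans; cong; cong₂; subst; ≡-≟-identity; module ≡-Reasoning)
open import Relation.Nullary using (¬_; Dec; yes; no; does; contradiction; ¬?)

import Algebra.Properties.CommutativeSemigroup as CommutativeSemigroupProperties
open CommutativeSemigroupProperties
  (CommutativeRing.+-commutativeSemigroup xor-∧-commutativeRing)
  using () renaming (interchange to xor-interchange)
open CommutativeSemigroupProperties +-commutativeSemigroup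
  using () renaming (interchange to +-interchange)

private
  variable
    n d : ℕ

-- Chains over F_2 and the boundary operator

Chain : ℕ → Set
Chain n = Subset n → Bool

-- The value at `τ` is the sum in F_2 of `X` over all sets obtained from `τ` by adding one vertex.
-- No degree enters, so one operator serves all dimensions, and it is the augmented one: the
-- boundary of a vertex is the empty set.
∂ : Chain n → Chain n
∂ {zero}  X []            = false
∂ {suc n} X (inside ∷ τ)  = ∂ (λ s → X (inside ∷ s)) τ
∂ {suc n} X (outside ∷ τ) = X (inside ∷ τ) xor ∂ (λ s → X (outside ∷ s)) τ

∂-support : (X : Chain n) (τ : Subset n) → ∂ X τ ≡ true →
            ∃ λ s → X s ≡ true × ∣ s ∣ ≡ suc ∣ τ ∣
∂-support {suc n} X (inside ∷ τ)  eq = let s , Xs , ∣s∣ = ∂-support _ τ eq in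
  inside ∷ s , Xs , cong suc ∣s∣
∂-support {suc n} X (outside ∷ τ) eq with X (inside ∷ τ) in Xτ
... | true  = inside ∷ τ , Xτ , refl
... | false = let s , Xs , ∣s∣ = ∂-support _ τ eq in outside ∷ s , Xs , ∣s∣

size : Chain n → ℕ
size {zero}  X = if X [] then 1 else 0
size {suc n} X = size (λ s → X (outside ∷ s)) + size (λ s → X (inside ∷ s))

empty : Chain n
empty _ = false

_⊕_ : Chain n → Chain n → Chain n
(X ⊕ Y) s = X s xor Y s

_⊑_ : Chain n → Chain n → Set
Y ⊑ X = ∀ s → Y s ≡ true → X s ≡ true

-- The grading is by cardinality: a chain of d-simplices is homogeneous of degree d + 1.
Homogeneous : ℕ → Chain n → Set
Homogeneous k X = ∀ s → X s ≡ true → ∣ s ∣ ≡ k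

Closed : Chain n → Set
Closed X = ∂ X ≗ empty

-- Independence in the simplicial matroid: the boundaries of the members of `F` are linearly
-- independent over F_2.
Acyclic : Chain n → Set
Acyclic F = ∀ Y → Y ⊑ F → Closed Y → Y ≗ empty

Nonzero : Chain n → Set
Nonzero X = ∃ λ s → X s ≡ true

false≢true : false ≢ true
false≢true ()

≢true⇒≡false : ∀ {b} → b ≢ true → b ≡ false
≢true⇒≡false {false} _   = refl
≢true⇒≡false {true}  b≢t = contradiction refl b≢t

xor≡false⇒≡ : ∀ a b → a xor b ≡ false → a ≡ b
xor≡false⇒≡ false b eq = sym eq
xor≡false⇒≡ true  true eq = refl

nonzero? : (X : Chain n) → Nonzero X ⊎ X ≗ empty
nonzero? X with anySubset? (λ s → X s ≟ᵇ true)
... | yes nz = inj₁ nz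
... | no ¬nz = inj₂ λ s → ≢true⇒≡false λ eq → ¬nz (s , eq)

∂-cong : {X Y : Chain n} → X ≗ Y → ∂ X ≗ ∂ Y
∂-cong {zero}  eq []            = refl
∂-cong {suc n} eq (inside ∷ τ)  = ∂-cong (λ s → eq (inside ∷ s)) τ
∂-cong {suc n} eq (outside ∷ τ) =
  cong₂ _xor_ (eq (inside ∷ τ)) (∂-cong (λ s → eq (outside ∷ s)) τ)

∂-empty : Closed (empty {n})
∂-empty []            = refl
∂-empty (inside ∷ τ)  = ∂-empty τ
∂-empty (outside ∷ τ) = ∂-empty τ

∂-⊕ : (X Y : Chain n) → ∂ (X ⊕ Y) ≗ (∂ X ⊕ ∂ Y)
∂-⊕ {zero}  X Y []            = refl
∂-⊕ {suc n} X Y (inside ∷ τ)  = ∂-⊕ _ _ τ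
∂-⊕ {suc n} X Y (outside ∷ τ) = trans
  (cong ((X (inside ∷ τ) xor Y (inside ∷ τ)) xor_) (∂-⊕ _ _ τ))
  (xor-interchange (X (inside ∷ τ)) (Y (inside ∷ τ)) _ _)

size-cong : {X Y : Chain n} → X ≗ Y → size X ≡ size Y
size-cong {zero}  eq = cong (if_then 1 else 0) (eq [])
size-cong {suc n} eq =
  cong₂ _+_ (size-cong (λ s → eq (outside ∷ s))) (size-cong (λ s → eq (inside ∷ s)))

size-empty : ∀ n → size (empty {n}) ≡ 0
size-empty zero    = refl
size-empty (suc n) = cong₂ _+_ (size-empty n) (size-empty n)

empty-acyclic : Acyclic (empty {n})
empty-acyclic Y Y⊑∅ _ s = ≢true⇒≡false λ eq → false≢true (Y⊑∅ s eq)

-- Decomposing and gluing chains at a vertex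

-- With respect to the vertex i, a chain is the sum of slice i outside X and of
-- the cone from i over slice i inside X (the link of i).
slice : Fin (suc n) → Bool → Chain (suc n) → Chain n
slice i b X s = X (insertAt s i b)

insertAt-elim : (i : Fin (suc n)) (P : Subset (suc n) → Set) →
                (∀ s b → P (insertAt s i b)) → ∀ s → P s
insertAt-elim i P p s = subst P (insertAt-removeAt s i) (p (removeAt s i) (lookup s i))

-- For `X` = A + vL the boundary is (L + ∂A) + v∂L; this lemma and `∂-slice-outside` read off the
-- two parts.
∂-slice-inside : ∀ i (X : Chain (suc n)) → slice i inside (∂ X) ≗ ∂ (slice i inside X)
∂-slice-inside         zero    X τ             = refl
∂-slice-inside {suc n} (suc i) X (inside ∷ τ)  = ∂-slice-inside i _ τ
∂-slice-inside {suc n} (suc i) X (outside ∷ τ) =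
  cong (X (inside ∷ insertAt τ i inside) xor_) (∂-slice-inside i _ τ)

∂-slice-outside : ∀ i (X : Chain (suc n)) →
                  slice i outside (∂ X) ≗ (slice i inside X ⊕ ∂ (slice i outside X))
∂-slice-outside         zero    X τ             = refl
∂-slice-outside {suc n} (suc i) X (inside ∷ τ)  = ∂-slice-outside i _ τ
∂-slice-outside {suc n} (suc i) X (outside ∷ τ) = trans
  (cong (X (inside ∷ insertAt τ i outside) xor_) (∂-slice-outside i _ τ))
  (xor-swap (X (inside ∷ insertAt τ i outside)) (X (outside ∷ insertAt τ i inside)) _)
  where
  xor-swap : ∀ a b c → a xor (b xor c) ≡ b xor (a xor c)
  xor-swap false b c = refl
  xor-swap true  b c = not-distribʳ-xor b c

size-slice : ∀ i (X : Chain (suc n)) →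
             size X ≡ size (slice i outside X) + size (slice i inside X)
size-slice         zero    X = refl
size-slice {suc n} (suc i) X = trans
  (cong₂ _+_ (size-slice i (λ s → X (outside ∷ s))) (size-slice i (λ s → X (inside ∷ s))))
  (+-interchange (size (λ s → X (outside ∷ insertAt s i outside))) _ _ _)

∣insertAt-inside∣ : ∀ (s : Subset n) i → ∣ insertAt s i inside ∣ ≡ suc ∣ s ∣
∣insertAt-inside∣ s             zero    = refl
∣insertAt-inside∣ (inside ∷ s)  (suc i) = cong suc (∣insertAt-inside∣ s i)
∣insertAt-inside∣ (outside ∷ s) (suc i) = ∣insertAt-inside∣ s i

∣insertAt-outside∣ : ∀ (s : Subset n) i → ∣ insertAt s i outside ∣ ≡ ∣ s ∣
∣insertAt-outside∣ s             zero    = refl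
∣insertAt-outside∣ (inside ∷ s)  (suc i) = cong suc (∣insertAt-outside∣ s i)
∣insertAt-outside∣ (outside ∷ s) (suc i) = ∣insertAt-outside∣ s i

slice-inside-homogeneous : ∀ {k} i {X : Chain (suc n)} →
  Homogeneous (suc k) X → Homogeneous k (slice i inside X)
slice-inside-homogeneous i hX s Xs =
  suc-injective (trans (sym (∣insertAt-inside∣ s i)) (hX _ Xs))

slice-outside-homogeneous : ∀ {k} i {X : Chain (suc n)} →
  Homogeneous k X → Homogeneous k (slice i outside X)
slice-outside-homogeneous i hX s Xs = trans (sym (∣insertAt-outside∣ s i)) (hX _ Xs)

⊕-homogeneous : ∀ {k} {X Y : Chain n} →
  Homogeneous k X → Homogeneous k Y → Homogeneous k (X ⊕ Y)
⊕-homogeneous {X = X} {Y} hX hY s eq with X s in Xs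
... | true  = hX s Xs
... | false = hY s eq

link-closed : ∀ i {X : Chain (suc n)} → Closed X → Closed (slice i inside X)
link-closed i {X} cX τ = trans (sym (∂-slice-inside i X τ)) (cX (insertAt τ i inside))

∂-slice-outside≗link : ∀ i {X : Chain (suc n)} → Closed X →
                       slice i inside X ≗ ∂ (slice i outside X)
∂-slice-outside≗link i {X} cX τ = xor≡false⇒≡ _ _
  (trans (sym (∂-slice-outside i X τ)) (cX (insertAt τ i outside)))

-- B plus the cone from the vertex i over G.
glue : Fin (suc n) → Chain n → Chain n → Chain (suc n)
glue i B G s = if lookup s i then G (removeAt s i) else B (removeAt s i)

glue-insertAt : ∀ i (B G : Chain n) s b →
                glue i B G (insertAt s i b) ≡ (if b then G s else B s)
glue-insertAt i B G s b
  rewrite insertAt-lookup s i b | removeAt-insertAt s i b = refl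

module _ (i : Fin (suc n)) (B G : Chain n) where

  slice-outside-glue : slice i outside (glue i B G) ≗ B
  slice-outside-glue s = glue-insertAt i B G s outside

  slice-inside-glue : slice i inside (glue i B G) ≗ G
  slice-inside-glue s = glue-insertAt i B G s inside

  size-glue : size (glue i B G) ≡ size B + size G
  size-glue = trans (size-slice i (glue i B G))
    (cong₂ _+_ (size-cong slice-outside-glue) (size-cong slice-inside-glue))

  glue-homogeneous : ∀ {k} → Homogeneous (suc k) B → Homogeneous k G →
                     Homogeneous (suc k) (glue i B G)
  glue-homogeneous {k} hB hG = insertAt-elim i _ λ where
    s inside  eq → trans (∣insertAt-inside∣ s i)
                     (cong suc (hG s (trans (sym (slice-inside-glue s)) eq)))
    s outside eq → trans (∣insertAt-outside∣ s i)
                     (hB s (trans (sym (slice-outside-glue s)) eq))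

  ∂-glue : (Z : Chain (suc n)) → ∂ G ≗ slice i inside Z →
           (G ⊕ ∂ B) ≗ slice i outside Z → ∂ (glue i B G) ≗ Z
  ∂-glue Z inside-eq outside-eq = insertAt-elim i _ λ where
    s inside  → trans (∂-slice-inside i (glue i B G) s)
                  (trans (∂-cong slice-inside-glue s) (inside-eq s))
    s outside → trans (∂-slice-outside i (glue i B G) s)
                  (trans (cong₂ _xor_ (slice-inside-glue s) (∂-cong slice-outside-glue s))
                         (outside-eq s))

  slice-inside-⊑ : ∀ {Y} → Y ⊑ glue i B G → slice i inside Y ⊑ G
  slice-inside-⊑ Y⊑ s eq = trans (sym (slice-inside-glue s)) (Y⊑ _ eq)

  slice-outside-⊑ : ∀ {Y} → Y ⊑ glue i B G → slice i outside Y ⊑ B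
  slice-outside-⊑ Y⊑ s eq = trans (sym (slice-outside-glue s)) (Y⊑ _ eq)

  -- The link of a cycle inside B + vG is a cycle inside `G`, hence empty. The rest of the cycle has
  -- this link as its boundary, so it is a cycle inside `B`, hence empty too.
  glue-acyclic : Acyclic B → Acyclic G → Acyclic (glue i B G)
  glue-acyclic aB aG Y Y⊑ cY = insertAt-elim i _ λ where
      s inside  → link≗∅ s
      s outside → aB _ (slice-outside-⊑ Y⊑)
                    (λ τ → trans (sym (∂-slice-outside≗link i cY τ)) (link≗∅ τ)) s
    where
    link≗∅ : slice i inside Y ≗ empty
    link≗∅ = aG _ (slice-inside-⊑ Y⊑) (link-closed i cY)

-- Binomial coefficients and the deficiency bound

pascal : ∀ n k → suc n C suc k ≡ n C k + n C suc k
pascal n k = sym (nCk+nC[k+1]≡[n+1]C[k+1] n k)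

choose-d-2-pascal : ∀ n d → choose-d-2 (suc n) (suc d) ≡ choose-d-2 n d + choose-d-2 n (suc d)
choose-d-2-pascal n zero          = refl
choose-d-2-pascal n (suc zero)    = refl
choose-d-2-pascal n (suc (suc k)) = pascal n k

-- Unimodality of the binomial coefficients, compared two steps apart.
C≤choose-d-2 : ∀ n d → n ≤ d + d → n C suc d ≤ choose-d-2 n (suc d)
C≤choose-d-2 zero    d       _ = z≤n
C≤choose-d-2 (suc n) (suc e) n≤2d with m≤n⇒m<n∨m≡n n≤2d
... | inj₁ n<2d = begin
    suc n C suc (suc e)                         ≡⟨ pascal n (suc e) ⟩
    n C suc e + n C suc (suc e)                 ≤⟨ +-mono-≤ (C≤choose-d-2 n e n≤2e) (C≤choose-d-2 n (suc e) (<⇒≤ (≤-pred (m≤n⇒m≤1+n n<2d)))) ⟩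
    choose-d-2 n (suc e) + choose-d-2 n (suc (suc e)) ≡⟨ choose-d-2-pascal n (suc e) ⟨
    suc n C e                                   ∎
  where
  open ≤-Reasoning
  n≤2e : n ≤ e + e
  n≤2e = ≤-pred (subst (suc n ≤_) (+-suc e e) (≤-pred n<2d))
-- At the extreme value Pascal's rule would leave the permitted range, but there both sides agree by
-- symmetry: with d = e + 1 the top entry is 2d = e + (e + 2).
... | inj₂ n≡2d = ≤-reflexive (begin
    suc n C suc (suc e)                             ≡⟨ cong (_C suc (suc e)) n≡2+2e ⟩
    (e + suc (suc e)) C suc (suc e)                 ≡⟨ nCk≡nC[n∸k] (m≤n+m (suc (suc e)) e) ⟩
    (e + suc (suc e)) C (e + suc (suc e) ∸ suc (suc e)) ≡⟨ cong₂ _C_ (sym n≡2+2e) (m+n∸n≡m e (suc (suc e))) ⟩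
    suc n C e                                       ∎)
  where
  open ≡-Reasoning
  n≡2+2e : suc n ≡ e + suc (suc e)
  n≡2+2e = trans n≡2d (sym (+-suc e (suc e)))

-- Acyclic fillings and how to avoid given chains

-- C(n,d) is the rank of the boundary operator on the d-simplices of n + 1 vertices. The upper bound
-- is a field because the induction that builds the filling yields it by Pascal's rule. The lower
-- bound is additive to keep clear of truncated subtraction.
record Filling (d : ℕ) (Z : Chain (suc n)) : Set where
  field
    chain       : Chain (suc n)
    homogeneous : Homogeneous (suc d) chain
    boundary    : ∂ chain ≗ Z
    acyclic     : Acyclic chain
    size-upper  : size chain ≤ n C d
    size-lower  : n C d ≤ size chain + choose-d-2 n d

-- Being different means having a witnessing simplex, which can then be carried from a link to the
-- glued chain.
_Avoids_ : Chain n → List (Chain n) → Set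
F Avoids Xs = All (λ X → ∃ λ s → F s ≢ X s) Xs

avoids-none : (F : Chain n) (Xs : List (Chain n)) → length Xs ≤ 0 → F Avoids Xs
avoids-none F [] z≤n = []

-- The test sets `e v` tell the n + 1 chains `F u` apart. If every listed chain vanishes at
-- `e zero`, then `F zero` avoids them all. Otherwise the listed chains that do not vanish there
-- differ from every `F (suc u)`; dropping them, at least one, pays for dropping the index `zero`.
pigeonhole : ∀ {m} (e : Fin (suc n) → Subset m) (F : Fin (suc n) → Chain m) →
             (∀ u v → F u (e v) ≡ does (u ≟ᶠ v)) →
             ∀ Xs → length Xs ≤ n → ∃ λ u → F u Avoids Xs
pigeonhole e F Fe Xs len with All.all? (λ X → X (e zero) ≟ᵇ false) Xs
... | yes all = zero , All.map (λ X≡false → e zero , λ F≡X → false≢true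
      (trans (sym X≡false) (trans (sym F≡X) (Fe zero zero)))) all
pigeonhole {zero}  e F Fe [] z≤n | no ¬all = contradiction [] ¬all
pigeonhole {suc n} e F Fe Xs len | no ¬all = suc u , Allₚ.filter⁻ misses? avoids
    (All.map (λ X≢false → e zero , λ F≡X → X≢false (trans (sym F≡X) (Fe (suc u) zero)))
             (Allₚ.all-filter (λ X → ¬? (misses? X)) Xs))
  where
  misses? = λ X → X (e zero) ≟ᵇ false

  rest : ∃ λ u → F (suc u) Avoids filter misses? Xs
  rest = pigeonhole (λ v → e (suc v)) (λ v → F (suc v)) (λ u v → Fe (suc u) (suc v)) _
    (≤-pred (≤-trans (filter-notAll misses? Xs (Allₚ.¬All⇒Any¬ misses? Xs ¬all)) len))

  u      = proj₁ rest
  avoids = proj₂ rest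

-- Filling the chain of the empty set by single vertices

∣∣≡0-unique : (s t : Subset n) → ∣ s ∣ ≡ 0 → ∣ t ∣ ≡ 0 → s ≡ t
∣∣≡0-unique []            []            _  _  = refl
∣∣≡0-unique (outside ∷ s) (outside ∷ t) s0 t0 = cong (outside ∷_) (∣∣≡0-unique s t s0 t0)

lookup-⁅⁆ : (v u : Fin n) → lookup ⁅ v ⁆ u ≡ does (u ≟ᶠ v)
lookup-⁅⁆ zero    zero    = refl
lookup-⁅⁆ zero    (suc u) = lookup-replicate u outside
lookup-⁅⁆ (suc v) zero    = refl
lookup-⁅⁆ (suc v) (suc u) = lookup-⁅⁆ v u

size-homogeneous-0 : (X : Chain n) → Homogeneous 0 X → Nonzero X → size X ≡ 1
size-homogeneous-0 {zero}  X hX ([] , eq)            = cong (if_then 1 else 0) eq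
size-homogeneous-0 {suc n} X hX (inside ∷ s , eq)    with () ← hX _ eq
size-homogeneous-0 {suc n} X hX (outside ∷ s , eq)   = cong₂ _+_
  (size-homogeneous-0 (λ s → X (outside ∷ s)) (λ s → hX (outside ∷ s)) (s , eq))
  (trans (size-cong {X = λ s → X (inside ∷ s)} (λ s → ≢true⇒≡false λ Xs → 1+n≢0 (hX _ Xs)))
         (size-empty n))

module _ (Z : Chain (suc n)) (hZ : Homogeneous 0 Z) (cZ : Closed Z) (nzZ : Nonzero Z) where

  private
    base : Fin (suc n) → Chain n
    base u = slice u outside Z

    base-homogeneous : ∀ u → Homogeneous 0 (base u)
    base-homogeneous u = slice-outside-homogeneous u hZ

    Z-full : ∀ s → ∣ s ∣ ≡ 0 → Z s ≡ true
    Z-full s s0 = let t , Zt = nzZ in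
      subst (λ s → Z s ≡ true) (∣∣≡0-unique t s (hZ t Zt) s0) Zt

    base-⊥ : ∀ s u → ∣ s ∣ ≡ 0 → base u s ≡ true
    base-⊥ s u s0 = Z-full _ (trans (∣insertAt-outside∣ s u) s0)

    -- Here `Z` and `base u` consist of the empty set alone, so this cone is the single vertex u.
    -- Writing it with `glue` makes the lemmas on slices available.
    vertex : Fin (suc n) → Chain (suc n)
    vertex u = glue u empty (base u)

    ∣removeAt-⁅⁆∣ : (u : Fin (suc n)) → ∣ removeAt ⁅ u ⁆ u ∣ ≡ 0
    ∣removeAt-⁅⁆∣ u = suc-injective (begin
      suc ∣ removeAt ⁅ u ⁆ u ∣                 ≡⟨ ∣insertAt-inside∣ (removeAt ⁅ u ⁆ u) u ⟨
      ∣ insertAt (removeAt ⁅ u ⁆ u) u inside ∣ ≡⟨ cong (λ b → ∣ insertAt (removeAt ⁅ u ⁆ u) u b ∣) lookup≡inside ⟨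
      ∣ insertAt (removeAt ⁅ u ⁆ u) u (lookup ⁅ u ⁆ u) ∣ ≡⟨ cong ∣_∣ (insertAt-removeAt ⁅ u ⁆ u) ⟩
      ∣ ⁅ u ⁆ ∣                                ≡⟨ ∣⁅x⁆∣≡1 u ⟩
      1                                        ∎)
      where
      open ≡-Reasoning
      lookup≡inside : lookup ⁅ u ⁆ u ≡ inside
      lookup≡inside = trans (lookup-⁅⁆ u u) (cong does (≡-≟-identity _≟ᶠ_ {u} refl))

    vertex-⁅⁆ : ∀ u v → vertex u ⁅ v ⁆ ≡ does (u ≟ᶠ v)
    vertex-⁅⁆ u v rewrite lookup-⁅⁆ v u with u ≟ᶠ v
    ... | yes refl = base-⊥ _ u (∣removeAt-⁅⁆∣ u)
    ... | no _     = refl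

    -- `glue-acyclic` does not apply, since `base u` is itself a nonzero cycle. Instead the part of
    -- `Y` away from u is empty, and the link of `Y` is the boundary of that part.
    vertex-acyclic : ∀ u → Acyclic (vertex u)
    vertex-acyclic u Y Y⊑ cY = insertAt-elim u _ λ where
        s inside  → trans (∂-slice-outside≗link u cY s) (trans (∂-cong outside≗∅ s) (∂-empty s))
        s outside → outside≗∅ s
      where
      outside≗∅ : slice u outside Y ≗ empty
      outside≗∅ s = ≢true⇒≡false λ eq → false≢true (slice-outside-⊑ u empty (base u) Y⊑ s eq)

    vertex-filling : Fin (suc n) → Filling 0 Z
    vertex-filling u = record
      { chain       = vertex u
      ; homogeneous = glue-homogeneous u empty (base u) (λ s ()) (base-homogeneous u)
      ; boundary    = ∂-glue u empty (base u) Z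
          (λ τ → sym (∂-slice-outside≗link u cZ τ))
          (λ τ → trans (cong (base u τ xor_) (∂-empty τ)) (xor-identityʳ (base u τ)))
      ; acyclic     = vertex-acyclic u
      ; size-upper  = ≤-reflexive size≡1
      ; size-lower  = ≤-reflexive (trans (sym size≡1) (sym (+-identityʳ _)))
      }
      where
      size≡1 : size (vertex u) ≡ 1
      size≡1 = trans (size-glue u empty (base u))
        (cong₂ _+_ (size-empty n) (size-homogeneous-0 (base u) (base-homogeneous u)
          (⊥ , base-⊥ ⊥ u (∣⊥∣≡0 n))))

  filling₀ : ∀ Xs → length Xs ≤ n → ∃ λ (F : Filling 0 Z) → Filling.chain F Avoids Xs
  filling₀ Xs len = let u , avoids = pigeonhole ⁅_⁆ vertex vertex-⁅⁆ Xs len in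
    vertex-filling u , avoids

-- Fillings in all degrees, by induction on the number of vertices

vertex-of : ∀ (s : Subset n) {k} → ∣ s ∣ ≡ suc k → ∃ λ i → lookup s i ≡ inside
vertex-of (inside ∷ s)  _  = zero , refl
vertex-of (outside ∷ s) eq = let i , s[i] = vertex-of s eq in suc i , s[i]

-- Distinct G give distinct B + vG, so to avoid Xs it is enough that G avoids their
-- links; G must also avoid A, and n - 2d grows by exactly one in passing from Z to L.
filling : ∀ n d (Z : Chain (suc n)) → Homogeneous d Z → Closed Z → Nonzero Z →
          ∀ Xs → length Xs ≤ n ∸ (d + d) →
          ∃ λ (F : Filling d Z) → Filling.chain F Avoids Xs
filling n       zero    Z hZ cZ nzZ Xs len = filling₀ Z hZ cZ nzZ Xs len
-- On one vertex there is no nonzero cycle of positive degree: the vertex has the empty set as its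
-- boundary, and the empty set has degree 0.
filling zero    (suc d) Z hZ cZ (inside ∷ [] , Zs)  Xs len = contradiction
  (trans (sym (cZ (outside ∷ []))) (trans (xor-identityʳ _) Zs)) false≢true
filling zero    (suc d) Z hZ cZ (outside ∷ [] , Zs) Xs len = contradiction (sym (hZ _ Zs)) 1+n≢0
filling (suc n) (suc d) Z hZ cZ (s , Zs) Xs len = decide (d + d <? n)
  where
  i = proj₁ (vertex-of s (hZ s Zs))

  A L : Chain (suc n)
  A = slice i outside Z
  L = slice i inside Z

  L-nonzero : Nonzero L
  L-nonzero = removeAt s i , trans
    (cong Z (trans (cong (insertAt (removeAt s i) i) (sym (proj₂ (vertex-of s (hZ s Zs))))) (insertAt-removeAt s i))) Zs

  fillingL : ∀ Ys → length Ys ≤ n ∸ (d + d) →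
             ∃ λ (G : Filling d L) → Filling.chain G Avoids Ys
  fillingL = filling n d L (slice-inside-homogeneous i hZ) (link-closed i cZ) L-nonzero

  module _ (G : Filling d L) where
    open Filling G renaming (chain to G-chain; homogeneous to G-homogeneous; boundary to ∂G;
      acyclic to G-acyclic; size-upper to G-upper; size-lower to G-lower)

    AG : Chain (suc n)
    AG = A ⊕ G-chain

    AG-closed : Closed AG
    AG-closed τ = trans (∂-⊕ A G-chain τ)
      (trans (cong₂ _xor_ (sym (∂-slice-outside≗link i cZ τ)) (∂G τ)) (xor-same (L τ)))

    AG-homogeneous : Homogeneous (suc d) AG
    AG-homogeneous = ⊕-homogeneous (slice-outside-homogeneous i hZ) G-homogeneous

    extend : Filling (suc d) AG → ∃ λ (F : Filling (suc d) Z) →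
             slice i inside (Filling.chain F) ≗ G-chain
    extend B = record
      { chain       = glue i B-chain G-chain
      ; homogeneous = glue-homogeneous i B-chain G-chain B-homogeneous G-homogeneous
      ; boundary    = ∂-glue i B-chain G-chain Z ∂G λ τ →
          trans (cong (G-chain τ xor_) (∂B τ)) (xor-cancel (G-chain τ) (A τ))
      ; acyclic     = glue-acyclic i B-chain G-chain B-acyclic G-acyclic
      ; size-upper  = begin
          size (glue i B-chain G-chain)   ≡⟨ size-glue i B-chain G-chain ⟩
          size B-chain + size G-chain     ≤⟨ +-mono-≤ B-upper G-upper ⟩
          n C suc d + n C d             ≡⟨ +-comm (n C suc d) _ ⟩
          n C d + n C suc d             ≡⟨ pascal n d ⟨
          suc n C suc d                  ∎
      ; size-lower  = begin
          suc n C suc d                  ≡⟨ pascal n d ⟩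
          n C d + n C suc d             ≡⟨ +-comm (n C d) _ ⟩
          n C suc d + n C d             ≤⟨ +-mono-≤ B-lower G-lower ⟩
          (size B-chain + choose-d-2 n (suc d)) + (size G-chain + choose-d-2 n d)
            ≡⟨ +-interchange (size B-chain) _ _ _ ⟩
          (size B-chain + size G-chain) + (choose-d-2 n (suc d) + choose-d-2 n d)
            ≡⟨ cong₂ _+_ (sym (size-glue i B-chain G-chain))
                 (trans (+-comm (choose-d-2 n (suc d)) _) (sym (choose-d-2-pascal n d))) ⟩
          size (glue i B-chain G-chain) + choose-d-2 (suc n) (suc d) ∎
      } , slice-inside-glue i B-chain G-chain
      where
      open ≤-Reasoning
      open Filling B renaming (chain to B-chain; homogeneous to B-homogeneous; boundary to ∂B;
        acyclic to B-acyclic; size-upper to B-upper; size-lower to B-lower)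
      xor-cancel : ∀ g a → g xor (a xor g) ≡ a
      xor-cancel false a = xor-identityʳ a
      xor-cancel true  true  = refl
      xor-cancel true  false = refl

    fill-AG : Nonzero AG → Filling (suc d) AG
    -- `B` has nothing to avoid, because the choice of `G` alone keeps the glued chain away from
    -- `Xs`.
    fill-AG nz = proj₁ (filling n (suc d) AG AG-homogeneous AG-closed nz [] z≤n)

    fill-AG-empty : n ≤ d + d → AG ≗ empty → Filling (suc d) AG
    fill-AG-empty n≤2d AG≗∅ = record
      { chain       = empty
      ; homogeneous = λ s ()
      ; boundary    = λ τ → trans (∂-empty τ) (sym (AG≗∅ τ))
      ; acyclic     = empty-acyclic
      ; size-upper  = ≤-trans (≤-reflexive (size-empty (suc n))) z≤n
      ; size-lower  = ≤-trans (C≤choose-d-2 n d n≤2d) (m≤n+m _ (size (empty {suc n})))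
      }

  decide : Dec (d + d < n) → ∃ λ (F : Filling (suc d) Z) → Filling.chain F Avoids Xs
  decide (yes 2d<n) with fillingL (A ∷ map (slice i inside) Xs) len-Ys
    where
    open ≤-Reasoning
    len-Ys : length (A ∷ map (slice i inside) Xs) ≤ n ∸ (d + d)
    len-Ys = begin
      suc (length (map (slice i inside) Xs)) ≡⟨ cong suc (length-map (slice i inside) Xs) ⟩
      suc (length Xs)                        ≤⟨ s≤s len ⟩
      suc (n ∸ (d + suc d))                  ≡⟨ cong (λ m → suc (n ∸ m)) (+-suc d d) ⟩
      suc (n ∸ suc (d + d))                  ≡⟨ +-∸-assoc 1 2d<n ⟨
      n ∸ (d + d)                            ∎
  ... | G , (t , G≢A) ∷ G-avoids with nonzero? (AG G)
  ...   | inj₂ AG≗∅ = contradiction (sym (xor≡false⇒≡ _ _ (AG≗∅ t))) G≢A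
  ...   | inj₁ nz   = let F , link≗G = extend G (fill-AG G nz) in
    F , All.map (λ (t , G≢X) → insertAt t i inside , λ F≡X → G≢X (trans (sym (link≗G t)) F≡X))
                (Allₚ.map⁻ G-avoids)
  -- For n ≤ 2d the allowance on `Xs` truncates to 0, so any `G` will do, even one with A + G = 0.
  decide (no 2d≮n) = proj₁ (extend G fill-either) ,
      avoids-none _ Xs (≤-trans len (≤-reflexive (m≤n⇒m∸n≡0 (≤-trans n≤2d (+-monoʳ-≤ d (n≤1+n d))))))
    where
    n≤2d = ≮⇒≥ 2d≮n
    G = proj₁ (fillingL [] z≤n)

    fill-either : Filling (suc d) (AG G)
    fill-either with nonzero? (AG G)
    ... | inj₁ nz   = fill-AG G nz
    ... | inj₂ AG≗∅ = fill-AG-empty G n≤2d AG≗∅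

-- Simple cycles from cones

record IsSimple (Z : Chain n) : Set where
  field
    closed  : Closed Z
    nonzero : Nonzero Z
    minimal : ∀ Y → Y ⊑ Z → Closed Y → Nonzero Y → Z ⊑ Y

-- Let `Y` be a nonzero cycle inside F + vZ. Its link is a cycle inside `Z`, so it is empty or all
-- of `Z`. If empty, the rest of `Y` is a cycle inside the acyclic `F`, and `Y` vanishes. If it is
-- `Z`, then `F` and the rest of `Y` have the same boundary; their sum is a cycle inside `F`, hence
-- empty, and `Y` is everything.
cone-simple : {F Z : Chain n} → IsSimple Z → Acyclic F → ∂ F ≗ Z → IsSimple (glue zero F Z)
cone-simple {n} {F} {Z} simple aF ∂F = record
  { closed  = ∂-glue zero F Z empty closed (λ τ → trans (cong (Z τ xor_) (∂F τ)) (xor-same (Z τ)))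
  ; nonzero = let s , Zs = nonzero in inside ∷ s , Zs
  ; minimal = minimal′
  }
  where
  open IsSimple simple

  minimal′ : ∀ Y → Y ⊑ glue zero F Z → Closed Y → Nonzero Y → glue zero F Z ⊑ Y
  minimal′ Y Y⊑ cY (t , Yt) = decide (nonzero? Y-in)
    where
    Y-in Y-out : Chain n
    Y-in  = slice zero inside Y
    Y-out = slice zero outside Y

    decide : Nonzero Y-in ⊎ Y-in ≗ empty → glue zero F Z ⊑ Y
    decide (inj₂ in≗∅) = contradiction (trans (sym (Y≗∅ t)) Yt) false≢true
      where
      out≗∅ : Y-out ≗ empty
      out≗∅ = aF Y-out (slice-outside-⊑ zero F Z Y⊑)
        (λ τ → trans (sym (∂-slice-outside≗link zero cY τ)) (in≗∅ τ))

      Y≗∅ : Y ≗ empty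
      Y≗∅ (inside ∷ s)  = in≗∅ s
      Y≗∅ (outside ∷ s) = out≗∅ s
    decide (inj₁ nz) = λ where
        (inside ∷ s)  Zs → Z⊑in s Zs
        (outside ∷ s) Fs → trans (sym (xor≡false⇒≡ _ _ (F⊕out≗∅ s))) Fs
      where
      Z⊑in : Z ⊑ Y-in
      Z⊑in = minimal Y-in (slice-inside-⊑ zero F Z Y⊑) (link-closed zero cY) nz

      Z≗in : Z ≗ Y-in
      Z≗in s with Z s in Zs | Y-in s in Ys
      ... | true  | _     = trans (sym (Z⊑in s Zs)) Ys
      ... | false | false = refl
      ... | false | true  = trans (sym Zs) (slice-inside-⊑ zero F Z Y⊑ s Ys)

      F⊕out⊑F : (F ⊕ Y-out) ⊑ F
      F⊕out⊑F s eq with F s in Fs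
      ... | true  = refl
      ... | false = trans (sym Fs) (slice-outside-⊑ zero F Z Y⊑ s eq)

      F⊕out≗∅ : (F ⊕ Y-out) ≗ empty
      F⊕out≗∅ = aF _ F⊕out⊑F λ τ → trans (∂-⊕ F Y-out τ)
        (trans (cong₂ _xor_ (trans (∂F τ) (Z≗in τ)) (sym (∂-slice-outside≗link zero cY τ)))
               (xor-same (Y-in τ)))

record LargeSimpleCycle (d : ℕ) (m : ℕ) : Set where
  field
    chain       : Chain (suc m)
    homogeneous : Homogeneous (suc d) chain
    simple      : IsSimple chain
    size-upper  : size chain ≤ m C d + 1
    size-lower  : m C d + 1 ≤ size chain + choose-d-2 m d

-- The induction starts one dimension below 0: the chain `point` of the empty set is a simple cycle,
-- a vertex fills it, and the cone gives a pair of vertices. Each further step adds one vertex and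
-- one dimension, and the bounds add up by Pascal's rule.
largeSimpleCycle : ∀ d m → suc d ≤ m → LargeSimpleCycle d m
largeSimpleCycle zero    (suc m) _ = record
  { chain       = glue zero F.chain point
  ; homogeneous = glue-homogeneous zero F.chain point F.homogeneous point-homogeneous
  ; simple      = cone-simple point-simple F.acyclic F.boundary
  ; size-upper  = +-mono-≤ F.size-upper (≤-reflexive size-point)
  ; size-lower  = begin
      suc m C 0 + 1                               ≤⟨ +-mono-≤ F.size-lower (≤-reflexive (sym size-point)) ⟩
      (size F.chain + 0) + size point             ≡⟨ cong (_+ size point) (+-identityʳ (size F.chain)) ⟩
      size F.chain + size point                   ≡⟨ +-identityʳ _ ⟨
      (size F.chain + size point) + 0             ∎
  }
  where
  open ≤-Reasoning
  point : Chain (suc m)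
  point s = ∣ s ∣ ≡ᵇ 0

  point-homogeneous : Homogeneous 0 point
  point-homogeneous s eq = ≡ᵇ⇒≡ ∣ s ∣ 0 (subst T (sym eq) tt)

  point-nonzero : Nonzero point
  point-nonzero = ⊥ , cong (_≡ᵇ 0) (∣⊥∣≡0 (suc m))

  size-point : size point ≡ 1
  size-point = size-homogeneous-0 point point-homogeneous point-nonzero

  point-closed : Closed point
  point-closed τ = ≢true⇒≡false λ eq → let s , s∈ , ∣s∣ = ∂-support point τ eq in
    1+n≢0 (trans (sym ∣s∣) (point-homogeneous s s∈))

  point-simple : IsSimple point
  point-simple = record
    { closed  = point-closed
    ; nonzero = point-nonzero
    ; minimal = λ Y Y⊑ _ (t , Yt) s s∈ → subst (λ s → Y s ≡ true)
        (∣∣≡0-unique t s (point-homogeneous t (Y⊑ t Yt)) (point-homogeneous s s∈)) Yt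
    }

  module F = Filling (proj₁ (filling m 0 point point-homogeneous point-closed point-nonzero [] z≤n))
largeSimpleCycle (suc d) (suc m) (s≤s d<m) = record
  { chain       = glue zero F.chain Z.chain
  ; homogeneous = glue-homogeneous zero F.chain Z.chain F.homogeneous Z.homogeneous
  ; simple      = cone-simple Z.simple F.acyclic F.boundary
  ; size-upper  = begin
      size F.chain + size Z.chain       ≤⟨ +-mono-≤ F.size-upper Z.size-upper ⟩
      m C suc d + (m C d + 1)           ≡⟨ pascal-1 ⟩
      suc m C suc d + 1                 ∎
  ; size-lower  = begin
      suc m C suc d + 1                 ≡⟨ pascal-1 ⟨
      m C suc d + (m C d + 1)           ≤⟨ +-mono-≤ F.size-lower Z.size-lower ⟩
      (size F.chain + choose-d-2 m (suc d)) + (size Z.chain + choose-d-2 m d)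
        ≡⟨ +-interchange (size F.chain) _ _ _ ⟩
      (size F.chain + size Z.chain) + (choose-d-2 m (suc d) + choose-d-2 m d)
        ≡⟨ cong ((size F.chain + size Z.chain) +_)
             (trans (+-comm (choose-d-2 m (suc d)) _) (sym (choose-d-2-pascal m d))) ⟩
      (size F.chain + size Z.chain) + choose-d-2 (suc m) (suc d) ∎
  }
  where
  open ≤-Reasoning
  module Z = LargeSimpleCycle (largeSimpleCycle d m d<m)
  module F = Filling (proj₁ (filling m (suc d) Z.chain Z.homogeneous
    (IsSimple.closed Z.simple) (IsSimple.nonzero Z.simple) [] z≤n))

  pascal-1 : m C suc d + (m C d + 1) ≡ suc m C suc d + 1
  pascal-1 = trans (sym (+-assoc (m C suc d) (m C d) 1))
    (cong (_+ 1) (trans (+-comm (m C suc d) (m C d)) (sym (pascal m d))))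

-- Translation between lists of simplices and chains

odd : ℕ → Bool
odd zero    = false
odd (suc n) = not (odd n)

odd-+ : ∀ m n → odd (m + n) ≡ odd m xor odd n
odd-+ zero    n = refl
odd-+ (suc m) n = trans (cong not (odd-+ m n)) (not-distribˡ-xor (odd m) (odd n))

2∣⇒even : ∀ {n} → 2 ∣ n → odd n ≡ false
2∣⇒even (divides zero    refl) = refl
2∣⇒even (divides (suc q) refl) = cong (λ b → not (not b)) (2∣⇒even (divides q refl))

even⇒2∣ : ∀ n → odd n ≡ false → 2 ∣ n
even⇒2∣ zero          _  = divides 0 refl
even⇒2∣ (suc (suc n)) eq with even⇒2∣ n (trans (sym (not-involutive (odd n))) eq)
... | divides q n≡q*2 = divides (suc q) (cong (λ m → suc (suc m)) n≡q*2)

indicator : Subset n → Chain n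
indicator []            []            = true
indicator (inside ∷ y)  (inside ∷ s)  = indicator y s
indicator (inside ∷ y)  (outside ∷ s) = false
indicator (outside ∷ y) (inside ∷ s)  = false
indicator (outside ∷ y) (outside ∷ s) = indicator y s

indicator-refl : (s : Subset n) → indicator s s ≡ true
indicator-refl []            = refl
indicator-refl (inside ∷ s)  = indicator-refl s
indicator-refl (outside ∷ s) = indicator-refl s

indicator⇒≡ : (y s : Subset n) → indicator y s ≡ true → y ≡ s
indicator⇒≡ []            []            _  = refl
indicator⇒≡ (inside ∷ y)  (inside ∷ s)  eq = cong (inside ∷_) (indicator⇒≡ y s eq)
indicator⇒≡ (outside ∷ y) (outside ∷ s) eq = cong (outside ∷_) (indicator⇒≡ y s eq)

⊆?-indicator : (τ y : Subset n) → ∣ y ∣ ≤ ∣ τ ∣ → does (τ ⊆? y) ≡ indicator y τ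
⊆?-indicator []            []            _  = refl
⊆?-indicator (inside ∷ τ)  (inside ∷ y)  le = ⊆?-indicator τ y (≤-pred le)
⊆?-indicator (inside ∷ τ)  (outside ∷ y) le = refl
⊆?-indicator (outside ∷ τ) (outside ∷ y) le = ⊆?-indicator τ y le
⊆?-indicator (outside ∷ τ) (inside ∷ y)  le with τ ⊆? y
... | yes τ⊆y = contradiction (≤-trans le (p⊆q⇒∣p∣≤∣q∣ τ⊆y)) 1+n≰n
... | no _    = refl

∂-indicator : (τ y : Subset n) → ∣ y ∣ ≡ suc ∣ τ ∣ → ∂ (indicator y) τ ≡ does (τ ⊆? y)
∂-indicator []            []            ()
∂-indicator (inside ∷ τ)  (inside ∷ y)  eq = ∂-indicator τ y (suc-injective eq)
∂-indicator (inside ∷ τ)  (outside ∷ y) eq = ∂-empty τ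
∂-indicator (outside ∷ τ) (outside ∷ y) eq = ∂-indicator τ y eq
∂-indicator (outside ∷ τ) (inside ∷ y)  eq = trans
  (cong (indicator y τ xor_) (∂-empty τ))
  (trans (xor-identityʳ _) (sym (⊆?-indicator τ y (≤-reflexive (suc-injective eq)))))

fromList : List (Subset n) → Chain n
fromList []      = empty
fromList (y ∷ Y) = indicator y ⊕ fromList Y

fromList⁻ : ∀ (Y : List (Subset n)) {s} → fromList Y s ≡ true → s ∈ Y
fromList⁻ (y ∷ Y) {s} eq with indicator y s in ys
... | true  = here (sym (indicator⇒≡ y s ys))
... | false = there (fromList⁻ Y eq)

fromList⁺ : ∀ {Y : List (Subset n)} {s} → Unique Y → s ∈ Y → fromList Y s ≡ true
fromList⁺ {Y = y ∷ Y} {s} (y∉Y ∷ _) (here refl) = cong₂ _xor_ (indicator-refl s)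
  (≢true⇒≡false λ eq → All.lookup y∉Y (fromList⁻ Y eq) refl)
fromList⁺ {Y = y ∷ Y} {s} (y∉Y ∷ u) (there s∈Y) = cong₂ _xor_
  (≢true⇒≡false λ eq → All.lookup y∉Y s∈Y (indicator⇒≡ y s eq)) (fromList⁺ u s∈Y)

-- Connects the counting in `InBoundary` with the operator `∂`, by additivity, one simplex at a
-- time.
∂-fromList : ∀ (Y : List (Subset n)) τ → All (λ s → ∣ s ∣ ≡ suc ∣ τ ∣) Y →
             ∂ (fromList Y) τ ≡ odd (countContaining τ Y)
∂-fromList []      τ []         = ∂-empty τ
∂-fromList (y ∷ Y) τ (∣y∣ ∷ hY) = begin
  ∂ (indicator y ⊕ fromList Y) τ                 ≡⟨ ∂-⊕ (indicator y) (fromList Y) τ ⟩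
  ∂ (indicator y) τ xor ∂ (fromList Y) τ         ≡⟨ cong₂ _xor_ (∂-indicator τ y ∣y∣) (∂-fromList Y τ hY) ⟩
  does (τ ⊆? y) xor odd (countContaining τ Y)    ≡⟨ odd-count ⟩
  odd (countContaining τ (y ∷ Y))                ∎
  where
  open ≡-Reasoning
  odd-count : does (τ ⊆? y) xor odd (countContaining τ Y) ≡ odd (countContaining τ (y ∷ Y))
  odd-count with does (τ ⊆? y)
  ... | true  = refl
  ... | false = refl

fromList-homogeneous : ∀ {k} {Y : List (Subset n)} → All (λ s → ∣ s ∣ ≡ k) Y →
                       Homogeneous k (fromList Y)
fromList-homogeneous {Y = Y} hY s eq = All.lookup hY (fromList⁻ Y eq)

-- `IsCycle` only tests sets of size d. At any other size the boundary vanishes, because by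
-- `∂-support` a set in it lies in a member of `Y` with exactly one more element.
IsCycle⇒Closed : ∀ {Y} → IsCycle n d Y → Closed (fromList Y)
IsCycle⇒Closed {d = d} {Y} ((hY , _) , ∂Y) τ = ≢true⇒≡false λ eq →
  let s , Ys , ∣s∣ = ∂-support (fromList Y) τ eq
      ∣τ∣≡d = suc-injective (trans (sym ∣s∣) (fromList-homogeneous hY s Ys))
      odd-count = trans (sym (∂-fromList Y τ (subst (λ e → All (λ s → ∣ s ∣ ≡ suc e) Y) (sym ∣τ∣≡d) hY))) eq
  in ∂Y τ (∣τ∣≡d , λ 2∣ → false≢true (trans (sym (2∣⇒even 2∣)) odd-count))

Closed⇒IsCycle : ∀ {Y} → IsChain n d Y → Closed (fromList Y) → IsCycle n d Y
Closed⇒IsCycle {Y = Y} (hY , uY) cY = (hY , uY) , λ where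
  τ (refl , ¬2∣) → ¬2∣ (even⇒2∣ _ (trans (sym (∂-fromList Y τ hY)) (cY τ)))

toList : Chain n → List (Subset n)
toList {zero}  X = if X [] then [] ∷ [] else []
toList {suc n} X = map (outside ∷_) (toList (λ s → X (outside ∷ s)))
                ++ map (inside ∷_) (toList (λ s → X (inside ∷ s)))

length-toList : (X : Chain n) → length (toList X) ≡ size X
length-toList {zero}  X with X []
... | true  = refl
... | false = refl
length-toList {suc n} X = trans
  (length-++ (map (outside ∷_) (toList (λ s → X (outside ∷ s)))))
  (cong₂ _+_ (trans (length-map _ (toList (λ s → X (outside ∷ s)))) (length-toList (λ s → X (outside ∷ s))))
             (trans (length-map _ (toList (λ s → X (inside ∷ s)))) (length-toList (λ s → X (inside ∷ s)))))

toList⁺ : (X : Chain n) → ∀ s → X s ≡ true → s ∈ toList X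
toList⁺ X []            eq rewrite eq = here refl
toList⁺ X (outside ∷ s) eq = ∈-++⁺ˡ (∈-map⁺ (outside ∷_) (toList⁺ _ s eq))
toList⁺ X (inside ∷ s)  eq = ∈-++⁺ʳ _ (∈-map⁺ (inside ∷_) (toList⁺ _ s eq))

toList⁻ : (X : Chain n) → ∀ {s} → s ∈ toList X → X s ≡ true
toList⁻ {zero}  X {[]} s∈ with X []
... | true  = refl
toList⁻ {suc n} X s∈ with ∈-++⁻ (map (outside ∷_) (toList (λ s → X (outside ∷ s)))) s∈
... | inj₁ s∈out with s , s∈X , refl ← ∈-map⁻ (outside ∷_) s∈out = toList⁻ _ s∈X
... | inj₂ s∈in  with s , s∈X , refl ← ∈-map⁻ (inside ∷_)  s∈in  = toList⁻ _ s∈X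

toList-unique : (X : Chain n) → Unique (toList X)
toList-unique {zero}  X with X []
... | true  = [] ∷ []
... | false = []
toList-unique {suc n} X = ++⁺
  (map⁺ ∷-injectiveʳ (toList-unique _)) (map⁺ ∷-injectiveʳ (toList-unique _)) disjoint
  where
  disjoint : ∀ {s} → ¬ (s ∈ map (outside ∷_) (toList (λ s → X (outside ∷ s)))
                      × s ∈ map (inside ∷_) (toList (λ s → X (inside ∷ s))))
  disjoint (s∈out , s∈in) with ∈-map⁻ (outside ∷_) s∈out | ∈-map⁻ (inside ∷_) s∈in
  ... | _ , _ , refl | _ , _ , ()

fromList-toList : (X : Chain n) → fromList (toList X) ≗ X
fromList-toList X s with X s in Xs
... | true  = fromList⁺ (toList-unique X) (toList⁺ X s Xs)
... | false = ≢true⇒≡false λ eq →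
  false≢true (trans (sym Xs) (toList⁻ X (fromList⁻ (toList X) eq)))

toList-simple : {X : Chain n} → Homogeneous (suc d) X → IsSimple X → IsSimpleCycle n d (toList X)
toList-simple {X = X} hX simple =
    Closed⇒IsCycle
      (All.tabulate (λ s∈ → hX _ (toList⁻ X s∈)) , toList-unique X)
      (λ τ → trans (∂-cong (fromList-toList X) τ) (closed τ))
  , (λ X≡[] → let s , Xs = nonzero in ∉[] (subst (s ∈_) X≡[] (toList⁺ X s Xs)))
  , no-proper-subcycle
  where
  open IsSimple simple

  ∉[] : ∀ {s : Subset _} → s ∉ []
  ∉[] ()

  ≢[]⇒∃∈ : ∀ {Y : List (Subset _)} → Y ≢ [] → ∃ λ s → s ∈ Y
  ≢[]⇒∃∈ {[]}    Y≢[] = contradiction refl Y≢[]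
  ≢[]⇒∃∈ {y ∷ Y} _    = y , here refl

  no-proper-subcycle : ∀ Y → NonemptyProperSubset Y (toList X) → ¬ IsCycle _ _ Y
  no-proper-subcycle Y (uY , Y⊆X , Y≢[] , s , s∈X , s∉Y) cycle =
    let y , y∈Y = ≢[]⇒∃∈ Y≢[]
        X⊑Y = minimal (fromList Y) (λ s Ys → toList⁻ X (Y⊆X (fromList⁻ Y Ys)))
                (IsCycle⇒Closed cycle) (y , fromList⁺ uY y∈Y)
    in s∉Y (fromList⁻ Y (X⊑Y s (toList⁻ X s∈X)))

-- Parity of the size of a 2-cycle and of C(m,2)

total : Chain n → Bool
total {zero}  X = X []
total {suc n} X = total (λ s → X (outside ∷ s)) xor total (λ s → X (inside ∷ s))

total-⊕ : (X Y : Chain n) → total (X ⊕ Y) ≡ total X xor total Y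
total-⊕ {zero}  X Y = refl
total-⊕ {suc n} X Y = trans
  (cong₂ _xor_ (total-⊕ (λ s → X (outside ∷ s)) (λ s → Y (outside ∷ s)))
               (total-⊕ (λ s → X (inside ∷ s)) (λ s → Y (inside ∷ s))))
  (xor-interchange (total (λ s → X (outside ∷ s))) (total (λ s → Y (outside ∷ s))) _ _)

total-cong : {X Y : Chain n} → X ≗ Y → total X ≡ total Y
total-cong {zero}  eq = eq []
total-cong {suc n} eq =
  cong₂ _xor_ (total-cong (λ s → eq (outside ∷ s))) (total-cong (λ s → eq (inside ∷ s)))

total-empty : ∀ n → total (empty {n}) ≡ false
total-empty zero    = refl
total-empty (suc n) = cong₂ _xor_ (total-empty n) (total-empty n)

total-indicator : (y : Subset n) → total (indicator y) ≡ true
total-indicator []                    = refl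
total-indicator {suc n} (inside ∷ y)  = cong₂ _xor_ (total-empty n) (total-indicator y)
total-indicator {suc n} (outside ∷ y) = cong₂ _xor_ (total-indicator y) (total-empty n)

total-fromList : (Y : List (Subset n)) → total (fromList Y) ≡ odd (length Y)
total-fromList {n} []  = total-empty n
total-fromList (y ∷ Y) = trans (total-⊕ (indicator y) (fromList Y))
  (cong₂ _xor_ (total-indicator y) (total-fromList Y))

-- A simplex with k vertices has k facets.
total-∂ : ∀ b (X : Chain n) → (∀ s → X s ≡ true → odd ∣ s ∣ ≡ b) → total (∂ X) ≡ b ∧ total X
total-∂ {zero}  b X hX with X [] in eq
... | true  = cong (_∧ true) (hX [] eq)
... | false = sym (∧-zeroʳ b)
total-∂ {suc n} b X hX = begin
  total (X-in ⊕ ∂ X-out) xor total (∂ X-in)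
    ≡⟨ cong (_xor total (∂ X-in)) (total-⊕ X-in (∂ X-out)) ⟩
  (total X-in xor total (∂ X-out)) xor total (∂ X-in)
    ≡⟨ cong₂ (λ p q → (total X-in xor p) xor q)
         (total-∂ b X-out (λ s → hX (outside ∷ s)))
         -- Deleting the first vertex lowers the cardinality by one, so the parity flips.
         (total-∂ (not b) X-in (λ s Xs → trans (sym (not-involutive _)) (cong not (hX (inside ∷ s) Xs)))) ⟩
  (total X-in xor (b ∧ total X-out)) xor (not b ∧ total X-in)
    ≡⟨ rearrange b (total X-in) (total X-out) ⟩
  b ∧ (total X-out xor total X-in) ∎
  where
  open ≡-Reasoning
  X-in X-out : Chain n
  X-in  s = X (inside ∷ s)
  X-out s = X (outside ∷ s)

  rearrange : ∀ b i o → (i xor (b ∧ o)) xor (not b ∧ i) ≡ b ∧ (o xor i)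
  rearrange true  i o = trans (xor-identityʳ _) (xor-comm i o)
  rearrange false i o = trans (cong (_xor i) (xor-identityʳ i)) (xor-same i)

-- A triangle has three edges, an odd number, so the size of `Z` has the parity of the size of its
-- boundary, which is empty.
2-cycle-even : ∀ {Z} → IsCycle n 2 Z → odd (length Z) ≡ false
2-cycle-even {n} {Z} cycle@((hZ , _) , _) = begin
  odd (length Z)          ≡⟨ total-fromList Z ⟨
  total (fromList Z)      ≡⟨ total-∂ true (fromList Z) (λ s Zs → cong odd (fromList-homogeneous hZ s Zs)) ⟨
  total (∂ (fromList Z))  ≡⟨ total-cong (IsCycle⇒Closed cycle) ⟩
  total (empty {n})       ≡⟨ total-empty n ⟩
  false                   ∎
  where open ≡-Reasoning

-- The recursion C(m+1,2) = m + C(m,2) read modulo 2; in this form the period 4 is a check of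
-- finitely many Boolean cases.
oddC2 : ℕ → Bool
oddC2 zero    = false
oddC2 (suc m) = odd m xor oddC2 m

odd-C2 : ∀ m → odd (m C 2) ≡ oddC2 m
odd-C2 zero    = refl
odd-C2 (suc m) = begin
  odd (suc m C 2)             ≡⟨ cong odd (pascal m 1) ⟩
  odd (m C 1 + m C 2)         ≡⟨ odd-+ (m C 1) (m C 2) ⟩
  odd (m C 1) xor odd (m C 2) ≡⟨ cong₂ (λ k b → odd k xor b) (nC1≡n m) (odd-C2 m) ⟩
  odd m xor oddC2 m           ∎
  where open ≡-Reasoning

oddC2-periodic : ∀ m → oddC2 (4 + m) ≡ oddC2 m
oddC2-periodic m with odd m | oddC2 m
... | true  | true  = refl
... | true  | false = refl
... | false | true  = refl
... | false | false = refl

-- C(m,2) is odd for m congruent to 2 or 3 modulo 4; with n = m + 1 these are the residues 3 and 0.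
oddC2⇒residue : ∀ m → oddC2 m ≡ true → suc m % 4 ≡ 0 ⊎ suc m % 4 ≡ 3
oddC2⇒residue 2 _ = inj₂ refl
oddC2⇒residue 3 _ = inj₁ refl
oddC2⇒residue (suc (suc (suc (suc m)))) eq =
  oddC2⇒residue m (trans (sym (oddC2-periodic m)) eq)

residue⇒oddC2 : ∀ m → suc m % 4 ≡ 0 ⊎ suc m % 4 ≡ 3 → oddC2 m ≡ true
residue⇒oddC2 0 (inj₁ ())
residue⇒oddC2 0 (inj₂ ())
residue⇒oddC2 1 (inj₁ ())
residue⇒oddC2 1 (inj₂ ())
residue⇒oddC2 2 _ = refl
residue⇒oddC2 3 _ = refl
residue⇒oddC2 (suc (suc (suc (suc m)))) r = trans (oddC2-periodic m) (residue⇒oddC2 m r)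

theorem3 : (∀ (n : ℕ) → 4 ≤ n →
    ((Σ (List (Subset n)) λ Z → IsHamiltonian n 2 Z)
    ⇔ ((n % 4 ≡ 0) ⊎ (n % 4 ≡ 3))))
    ×
    (∀ (d n : ℕ) → 1 ≤ d → d + 2 ≤ n →
    Σ (List (Subset n)) λ Z →
    IsSimpleCycle n d Z ×
    (((n ∸ 1) C d) + 1 ≤ length Z + choose-d-2 (n ∸ 1) d))
theorem3 = (λ where (suc m) (s≤s 3≤m) → mk⇔ (necessary m) (sufficient m 3≤m)) , large
  where
  necessary : ∀ m → Σ (List (Subset (suc m))) (IsHamiltonian (suc m) 2) →
              suc m % 4 ≡ 0 ⊎ suc m % 4 ≡ 3
  -- The size C(m,2) + 1 of a 2-cycle is even, so C(m,2) is odd.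
  necessary m (Z , (cycle , _) , length≡) = oddC2⇒residue m (begin
    oddC2 m                 ≡⟨ odd-C2 m ⟨
    odd (m C 2)             ≡⟨ not-involutive _ ⟨
    not (odd (1 + m C 2))   ≡⟨ cong (λ k → not (odd k)) (trans (+-comm 1 (m C 2)) (sym length≡)) ⟩
    not (odd (length Z))    ≡⟨ cong not (2-cycle-even cycle) ⟩
    true                    ∎)
    where open ≡-Reasoning

  sufficient : ∀ m → 3 ≤ m → suc m % 4 ≡ 0 ⊎ suc m % 4 ≡ 3 →
               Σ (List (Subset (suc m))) (IsHamiltonian (suc m) 2)
  sufficient m 3≤m r = toList chain , simple-list , ≤-antisym upper lower
    where
    open LargeSimpleCycle (largeSimpleCycle 2 m 3≤m)
    simple-list = toList-simple homogeneous simple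

    upper : length (toList chain) ≤ m C 2 + 1
    upper = subst (_≤ m C 2 + 1) (sym (length-toList chain)) size-upper

    -- For d = 2 the deficiency is at most C(m,0) = 1, so the only size to exclude is C(m,2), which
    -- is odd for these residues.
    C2≢length : m C 2 ≢ length (toList chain)
    C2≢length eq = false≢true (trans (sym (2-cycle-even (proj₁ simple-list)))
      (trans (cong odd (sym eq)) (trans (odd-C2 m) (residue⇒oddC2 m r))))

    lower : m C 2 + 1 ≤ length (toList chain)
    lower = subst (_≤ length (toList chain)) (+-comm 1 (m C 2)) (≤∧≢⇒< (+-cancelʳ-≤ 1 _ _
      (subst (λ k → m C 2 + 1 ≤ k + 1) (sym (length-toList chain)) size-lower)) C2≢length)

  large : ∀ d n → 1 ≤ d → d + 2 ≤ n → Σ (List (Subset n)) λ Z →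
          IsSimpleCycle n d Z × (((n ∸ 1) C d) + 1 ≤ length Z + choose-d-2 (n ∸ 1) d)
  large d zero    _ d+2≤n = contradiction (subst (_≤ 0) (+-comm d 2) d+2≤n) λ ()
  large d (suc m) _ d+2≤n = toList chain , toList-simple homogeneous simple ,
    subst (λ k → m C d + 1 ≤ k + choose-d-2 m d) (sym (length-toList chain)) size-lower
    where open LargeSimpleCycle (largeSimpleCycle d m (≤-pred (subst (_≤ suc m) (+-comm d 2) d+2≤n)))
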